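{- Let $F_{\mathsf p}=\mathcal D(-)\times\{0,1\}$ on $\mathbf{Sets}$, and let $\sigma_{\mathsf p}:F_{\mathsf p}[0,1]\to[0,1]$ be the modality $\sigma_{\mathsf p}(\delta,1)=1$, $\sigma_{\mathsf p}(\delta,0)=\sum_{a\in\mathrm{supp}(\delta)}a\cdot\delta(a)$ over $([0,1],\le)$. Fix a real number $\gamma\in[0,1)$. Define $r_{\mathsf{nc},\gamma}:F_{\mathsf p}[0,1]\to[0,1]$ by $$r_{\mathsf{nc},\gamma}(\varphi,t)=\begin{cases}1&(t=1)\\ \gamma\cdot\sum_{a\in\mathrm{supp}(\varphi)}a\cdot\varphi(a)&(t=0)\end{cases}$$ and $q_{\mathsf{nc}}:[0,1]\to[0,1]$ by $q_{\mathsf{nc}}(a)=a$. Then $(r_{\mathsf{nc},\gamma},q_{\mathsf{nc}},\le)$, where $\le$ is the usual order on $[0,1]$, is a ranking domain for $F_{\mathsf p}$ and $\sigma_{\mathsf p}$.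
   Context: $\mathcal D:\mathbf{Sets}\to\mathbf{Sets}$ is the discrete distribution functor: $\mathcal DX=\{d:X\to[0,1]\mid\sum_{x\in X}d(x)=1\}$ and $(\mathcal Df)(d)(y)=\sum_{x\in f^{ -1}(y)}d(x)$; $\mathrm{supp}(d)=\{x\mid d(x)>0\}$. $F_{\mathsf p}f=\mathcal Df\times\mathrm{id}$. For a functor $F:\mathbf{Sets}\to\mathbf{Sets}$, a coalgebra $c:X\to FX$ and an algebra $a:FA\to A$, put $\Phi_{c,a}(f)=a\circ Ff\circ c$ for $f\in A^X$. Functions into a poset are ordered pointwise. An algebra $r:FR\to R$ is corecursive if for every coalgebra $c:X\to FX$ there is exactly one $f:X\to R$ with $f=r\circ Ff\circ c$. Given a complete lattice $(\Omega,\sqsubseteq_\Omega)$ and an algebra (modality) $\sigma:F\Omega\to\Omega$ such that each $\Phi_{c,\sigma}$ is monotone, a ranking domain for $F$ and $\sigma$ is a triple $(r:FR\to R,\,q:R\to\Omega,\,\sqsubseteq_R)$, with $\sqsubseteq_R$ a partial order on $R$, such that: (1) $q\circ r\sqsubseteq_\Omega\sigma\circ Fq$ pointwise; (2) $(R,\sqsubseteq_R)$ is a complete lattice and $\Phi_{c,r}:R^X\to R^X$ is monotone for each coalgebra $c:X\to FX$; (3) $q$ is monotone, strict ($q(\bot_R)=\bot_\Omega$) and continuous ($q(\bigsqcup_{a\in K}a)=\bigsqcup_{a\in K}q(a)$ for each $K\subseteq R$); (4) $r$ is corecursive. -}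

module Defs where

open import Algebra.Bundles using (CommutativeRing)
open import Algebra.Structures using (IsCommutativeRing)
open import Axiom.ExcludedMiddle using (ExcludedMiddle)
open import Axiom.Extensionality.Propositional using (Extensionality)
open import Data.Empty using (⊥-elim)
open import Data.Fin.Base using (Fin)
open import Data.Fin.Patterns using (0F; 1F)
open import Data.Irrelevant using ([_])
open import Data.List.Base using (List; []; _∷_; _++_; map; foldr; filter; deduplicate)
open import Data.List.Membership.Propositional using (_∈_; _∉_)
open import Data.List.Membership.Propositional.Properties
  using (∈-map⁺; ∈-map⁻; ∈-++⁻; ∈-filter⁻; ∈-deduplicate⁺; ∈-deduplicate⁻)
open import Data.List.Relation.Unary.All as All using (All; []; _∷_)
import Data.List.Relation.Unary.All.Properties as All
open import Data.List.Relation.Unary.AllPairs using ([]; _∷_)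
open import Data.List.Relation.Unary.Any using (here; there)
open import Data.List.Relation.Unary.Unique.Propositional using (Unique)
import Data.List.Relation.Unary.Unique.Propositional.Properties as Unique
import Data.List.Relation.Unary.Unique.DecPropositional.Properties as DecUnique
open import Data.Product.Base using (∃; _×_; _,_; proj₁; proj₂)
open import Data.Product using (∃!)
open import Data.Refinement using (Refinement-syntax; _,_; value)
open import Data.Sum.Base using (inj₁; inj₂; [_,_]′)
open import Data.Unit.Base using (tt)
open import Function.Base using (_∘_; id; flip)
open import Level using (0ℓ)
open import Relation.Binary.Core using (Rel)
open import Relation.Binary.Definitions using (DecidableEquality)
open import Relation.Binary.PropositionalEquality
  using (_≡_; _≢_; refl; sym; trans; cong; subst; subst₂)
open import Relation.Binary.Structures using (IsPartialOrder; IsTotalOrder)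
import Relation.Binary.Construct.NonStrictToStrict as ToStrict
open import Relation.Nullary.Decidable using (yes; no; recompute; ¬?)
open import Relation.Unary using (Pred; U; ∅; _⊢_)

module _ {A : Set} (_≤_ : Rel A 0ℓ) where

  IsUpperBound : Pred A 0ℓ → Pred A 0ℓ
  IsUpperBound P u = ∀ {a} → P a → a ≤ u

  IsLUB : Pred A 0ℓ → Pred A 0ℓ
  IsLUB P s = IsUpperBound P s × (∀ {u} → IsUpperBound P u → s ≤ u)

record IsCompleteLattice {A : Set} (_≤_ : Rel A 0ℓ) : Set₁ where
  field
    isPartialOrder : IsPartialOrder _≡_ _≤_
    ⨆              : Pred A 0ℓ → A
    ⨆-isLUB        : ∀ K → IsLUB _≤_ K (⨆ K)
    ⨅              : Pred A 0ℓ → A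
    ⨅-isGLB        : ∀ K → IsLUB (flip _≤_) K (⨅ K)

  ⊥ : A
  ⊥ = ⨆ ∅

Image : {A B : Set} → (A → B) → Pred A 0ℓ → Pred B 0ℓ
Image q K b = ∃ λ a → K a × b ≡ q a

Pointwise : {X A : Set} → Rel A 0ℓ → Rel (X → A) 0ℓ
Pointwise _≤_ f g = ∀ x → f x ≤ g x

record SetFunctor : Set₁ where
  field
    F₀           : Set → Set
    F₁           : {X Y : Set} → (X → Y) → F₀ X → F₀ Y
    identity     : {X : Set} → F₁ {X} id ≡ id
    homomorphism : {X Y Z : Set} (f : X → Y) (g : Y → Z) →
                   F₁ (g ∘ f) ≡ F₁ g ∘ F₁ f

module _ (F : SetFunctor) where
  open SetFunctor F

  Φ : {X A : Set} → (X → F₀ X) → (F₀ A → A) → (X → A) → (X → A)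
  Φ c a f = a ∘ F₁ f ∘ c

  ΦMonotone : {A : Set} → Rel A 0ℓ → (F₀ A → A) → Set₁
  ΦMonotone {A} _≤_ a =
    {X : Set} (c : X → F₀ X) {f g : X → A} →
    Pointwise _≤_ f g → Pointwise _≤_ (Φ c a f) (Φ c a g)

  Corecursive : {R : Set} → (F₀ R → R) → Set₁
  Corecursive {R} r =
    {X : Set} (c : X → F₀ X) → ∃! _≡_ λ (f : X → R) → f ≡ Φ c r f

  -- The first two fields are the standing assumptions on the truth values Ω
  -- and the modality σ under which ranking domains are defined.
  record IsRankingDomain
      {Ω : Set} (_⊑Ω_ : Rel Ω 0ℓ) (σ : F₀ Ω → Ω)
      {R : Set} (r : F₀ R → R) (q : R → Ω) (_⊑R_ : Rel R 0ℓ) : Set₁ where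
    field
      Ω-isCompleteLattice : IsCompleteLattice _⊑Ω_
      σ-monotone          : ΦMonotone _⊑Ω_ σ

      R-isCompleteLattice : IsCompleteLattice _⊑R_

    private
      module Ω = IsCompleteLattice Ω-isCompleteLattice
      module R = IsCompleteLattice R-isCompleteLattice

    field
      lax          : Pointwise _⊑Ω_ (q ∘ r) (σ ∘ F₁ q)
      r-monotone   : ΦMonotone _⊑R_ r
      q-monotone   : ∀ {a b} → a ⊑R b → q a ⊑Ω q b
      q-strict     : q R.⊥ ≡ Ω.⊥
      q-continuous : ∀ (K : Pred R 0ℓ) → q (R.⨆ K) ≡ Ω.⨆ (Image q K)
      corecursive  : Corecursive r

-- The real numbers, axiomatised (up to isomorphism) as a Dedekind-complete
-- ordered field.
record CompleteOrderedField : Set₁ where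
  infix  8 -_
  infixl 7 _*_
  infixl 6 _+_
  infix  4 _≤_
  field
    ℝ                 : Set
    _+_ _*_           : ℝ → ℝ → ℝ
    -_                : ℝ → ℝ
    0# 1#             : ℝ
    _≤_               : Rel ℝ 0ℓ
    isCommutativeRing : IsCommutativeRing _≡_ _+_ _*_ -_ 0# 1#
    0≢1               : 0# ≢ 1#
    inverse           : ∀ x → x ≢ 0# → ∃ λ y → x * y ≡ 1#
    isTotalOrder      : IsTotalOrder _≡_ _≤_
    +-monoˡ-≤         : ∀ z {x y} → x ≤ y → x + z ≤ y + z
    *-nonNeg          : ∀ {x y} → 0# ≤ x → 0# ≤ y → 0# ≤ x * y
    complete          : (P : Pred ℝ 0ℓ) → ∃ P → ∃ (IsUpperBound _≤_ P) →
                        ∃ (IsLUB _≤_ P)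

  open ToStrict _≡_ _≤_ public using (_<_)

  commutativeRing : CommutativeRing 0ℓ 0ℓ
  commutativeRing = record { isCommutativeRing = isCommutativeRing }

module OrderedFieldProperties (𝓡 : CompleteOrderedField) where
  open CompleteOrderedField 𝓡
  open CommutativeRing commutativeRing public
    using (ring; +-comm; +-assoc; +-identityˡ; +-identityʳ;
           -‿inverseˡ; -‿inverseʳ; *-identityˡ; *-identityʳ; *-comm;
           distribʳ; distribˡ; zeroʳ)
  open IsTotalOrder isTotalOrder public
    using (antisym; total) renaming (refl to ≤-refl; trans to ≤-trans; reflexive to ≤-reflexive)
  open import Algebra.Properties.Ring ring public
    using (-‿distribˡ-*; -‿distribʳ-*; -‿involutive)

  +-mono-≤ : ∀ {a b c d} → a ≤ b → c ≤ d → a + c ≤ b + d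
  +-mono-≤ {a} {b} {c} {d} a≤b c≤d =
    ≤-trans (+-monoˡ-≤ c a≤b)
            (subst₂ _≤_ (+-comm c b) (+-comm d b) (+-monoˡ-≤ b c≤d))

  [x+y]-y≡x : ∀ x y → (x + y) + (- y) ≡ x
  [x+y]-y≡x x y = trans (+-assoc x y (- y))
    (trans (cong (x +_) (-‿inverseʳ y)) (+-identityʳ x))

  [x-y]+y≡x : ∀ x y → (x + (- y)) + y ≡ x
  [x-y]+y≡x x y = trans (+-assoc x (- y) y)
    (trans (cong (x +_) (-‿inverseˡ y)) (+-identityʳ x))

  x+y≤z⇒x≤z-y : ∀ {x y z} → x + y ≤ z → x ≤ z + (- y)
  x+y≤z⇒x≤z-y {x} {y} le = subst (_≤ _) ([x+y]-y≡x x y) (+-monoˡ-≤ (- y) le)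

  x≤z-y⇒x+y≤z : ∀ {x y z} → x ≤ z + (- y) → x + y ≤ z
  x≤z-y⇒x+y≤z {x} {y} {z} le = subst (_ ≤_) ([x-y]+y≡x z y) (+-monoˡ-≤ y le)

  0≤y-x : ∀ {x y} → x ≤ y → 0# ≤ y + (- x)
  0≤y-x {x} {y} le = subst (_≤ _) (-‿inverseʳ x) (+-monoˡ-≤ (- x) le)

  *-monoˡ-≤ : ∀ {z x y} → 0# ≤ z → x ≤ y → x * z ≤ y * z
  *-monoˡ-≤ {z} {x} {y} 0≤z x≤y =
    subst₂ _≤_ (+-identityˡ _) ([x-y]+y≡x (y * z) (x * z))
      (+-monoˡ-≤ (x * z)
        (subst (0# ≤_) (trans (distribʳ z y (- x))
                          (cong (y * z +_) (sym (-‿distribˡ-* x z))))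
          (*-nonNeg (0≤y-x x≤y) 0≤z)))

  0≤1 : 0# ≤ 1#
  0≤1 with total 0# 1#
  ... | inj₁ le = le
  ... | inj₂ 1≤0 = subst (0# ≤_) -1*-1≡1 (*-nonNeg 0≤-1 0≤-1)
    where
    0≤-1 : 0# ≤ - 1#
    0≤-1 = subst (0# ≤_) (+-identityˡ _) (0≤y-x 1≤0)
    -1*-1≡1 : (- 1#) * (- 1#) ≡ 1#
    -1*-1≡1 = trans (sym (-‿distribˡ-* 1# (- 1#)))
      (trans (cong -_ (*-identityˡ (- 1#))) (-‿involutive 1#))

  LUB-unique : ∀ {P Q s t} →
    (∀ {u} → IsUpperBound _≤_ P u → IsUpperBound _≤_ Q u) →
    (∀ {u} → IsUpperBound _≤_ Q u → IsUpperBound _≤_ P u) →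
    IsLUB _≤_ P s → IsLUB _≤_ Q t → s ≡ t
  LUB-unique P⇒Q Q⇒P (s-ub , s-least) (t-ub , t-least) =
    antisym (s-least (λ p → Q⇒P t-ub p)) (t-least (λ q → P⇒Q s-ub q))

module Sums (𝓡 : CompleteOrderedField) where
  open CompleteOrderedField 𝓡
  open OrderedFieldProperties 𝓡

  ∑ : {X : Set} → (X → ℝ) → List X → ℝ
  ∑ f xs = foldr _+_ 0# (map f xs)

  PartialSum : {X : Set} → Pred X 0ℓ → (X → ℝ) → Pred ℝ 0ℓ
  PartialSum {X} S f t =
    ∃ λ (xs : List X) → Unique xs × All S xs × t ≡ ∑ f xs

  -- HasSum S f s says that the sum of f x over x ∈ S is s.  It is used for
  -- nonnegative f only: the sum is the supremum of its finite partial sums.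
  HasSum : {X : Set} → Pred X 0ℓ → (X → ℝ) → Pred ℝ 0ℓ
  HasSum S f = IsLUB _≤_ (PartialSum S f)

  sumExists : {X : Set} (S : Pred X 0ℓ) (f : X → ℝ) →
              ∃ (IsUpperBound _≤_ (PartialSum S f)) → ∃ (HasSum S f)
  sumExists S f = complete (PartialSum S f) (0# , [] , [] , [] , refl)

  ∑-nonNeg : {X : Set} {f : X → ℝ} → (∀ x → 0# ≤ f x) → ∀ xs → 0# ≤ ∑ f xs
  ∑-nonNeg 0≤f []       = ≤-refl
  ∑-nonNeg 0≤f (x ∷ xs) =
    subst (_≤ ∑ _ (x ∷ xs)) (+-identityˡ 0#) (+-mono-≤ (0≤f x) (∑-nonNeg 0≤f xs))

  ∑-mono : {X : Set} {f g : X → ℝ} → (∀ x → f x ≤ g x) → ∀ xs → ∑ f xs ≤ ∑ g xs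
  ∑-mono f≤g []       = ≤-refl
  ∑-mono f≤g (x ∷ xs) = +-mono-≤ (f≤g x) (∑-mono f≤g xs)

  ∑-++ : {X : Set} (f : X → ℝ) (xs ys : List X) →
         ∑ f (xs ++ ys) ≡ ∑ f xs + ∑ f ys
  ∑-++ f []       ys = sym (+-identityˡ _)
  ∑-++ f (x ∷ xs) ys =
    trans (cong (f x +_) (∑-++ f xs ys)) (sym (+-assoc _ _ _))

  HasSum-nonNeg : {X : Set} {S : Pred X 0ℓ} {f : X → ℝ} {s : ℝ} →
                  HasSum S f s → 0# ≤ s
  HasSum-nonNeg (ub , _) = ub ([] , [] , [] , refl)

module Fibres (em : ExcludedMiddle 0ℓ) (𝓡 : CompleteOrderedField) where
  open CompleteOrderedField 𝓡
  open OrderedFieldProperties 𝓡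
  open Sums 𝓡

  module _ {X Y : Set} (f : X → Y) (d : X → ℝ) (e : Y → ℝ)
           (e-sum : ∀ y → HasSum (λ x → f x ≡ y) d (e y)) where

    private
      _≟_ : DecidableEquality Y
      _ ≟ _ = em

      ∑-split : ∀ y xs → ∑ d xs ≡ ∑ d (filter (λ x → f x ≟ y) xs)
                                + ∑ d (filter (λ x → ¬? (f x ≟ y)) xs)
      ∑-split y [] = sym (+-identityˡ 0#)
      ∑-split y (x ∷ xs) with f x ≟ y
      ... | yes _ = trans (cong (d x +_) (∑-split y xs)) (sym (+-assoc _ _ _))
      ... | no  _ = trans (cong (d x +_) (∑-split y xs))
        (trans (sym (+-assoc _ _ _))
          (trans (cong (_+ ∑ d (filter (λ x → ¬? (f x ≟ y)) xs)) (+-comm _ _))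
            (+-assoc _ _ _)))

      ∑-group : ∀ ys → Unique ys → ∀ xs → Unique xs → All (λ x → f x ∈ ys) xs →
                ∑ d xs ≤ ∑ e ys
      ∑-group []       _           []      _  _        = ≤-refl
      ∑-group []       _           (_ ∷ _) _  (() ∷ _)
      ∑-group (y ∷ ys) (_ ∷ ys!) xs      xs! xs∈ =
        subst (_≤ _) (sym (∑-split y xs)) (+-mono-≤
          (proj₁ (e-sum y) ( filter (λ x → f x ≟ y) xs
                           , Unique.filter⁺ (λ x → f x ≟ y) xs!
                           , All.all-filter (λ x → f x ≟ y) xs , refl))
          (∑-group ys ys! _ (Unique.filter⁺ (λ x → ¬? (f x ≟ y)) xs!)
            (All.tabulate λ x∈ →
              let x∈xs , fx≢y = ∈-filter⁻ (λ x → ¬? (f x ≟ y)) x∈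
              in drop fx≢y (All.lookup xs∈ x∈xs))))
        where
        drop : ∀ {z} → z ≢ y → z ∈ y ∷ ys → z ∈ ys
        drop z≢y (here z≡y)  = ⊥-elim (z≢y z≡y)
        drop z≢y (there z∈) = z∈

    module _ (T : Pred Y 0ℓ) {u : ℝ} where

      fibres-upper : IsUpperBound _≤_ (PartialSum (f ⊢ T) d) u →
                     IsUpperBound _≤_ (PartialSum T e) u
      fibres-upper d≤u (ys , ys! , Tys , refl) =
        subst (_≤ u) (+-identityˡ _) (go ys ys! Tys [] [] [] (λ ()))
        where
        go : ∀ ys → Unique ys → All T ys →
             ∀ xs → Unique xs → All (f ⊢ T) xs → (∀ {x} → x ∈ xs → f x ∉ ys) →
             ∑ d xs + ∑ e ys ≤ u
        go [] _ _ xs xs! Txs _ =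
          subst (_≤ u) (sym (+-identityʳ _)) (d≤u (xs , xs! , Txs , refl))
        go (y ∷ ys) (y∉ys ∷ ys!) (Ty ∷ Tys) xs xs! Txs fresh =
          subst (_≤ u) rearrange
            (x≤z-y⇒x+y≤z (proj₂ (e-sum y) λ where
              (zs , zs! , fzs≡y , refl) → x+y≤z⇒x≤z-y
                (subst (_≤ u)
                  (trans (cong (_+ ∑ e ys) (∑-++ d zs xs)) (+-assoc _ _ _))
                  (go ys ys! Tys (zs ++ xs)
                    (Unique.++⁺ zs! xs! λ (z∈zs , z∈xs) →
                      fresh z∈xs (here (All.lookup fzs≡y z∈zs)))
                    (All.++⁺ (All.map (λ fz≡y → subst T (sym fz≡y) Ty) fzs≡y) Txs)
                    (λ z∈ fz∈ys → [ (λ z∈zs →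
                          All.lookup y∉ys fz∈ys (sym (All.lookup fzs≡y z∈zs)))
                      , (λ z∈xs → fresh z∈xs (there fz∈ys)) ]′ (∈-++⁻ zs z∈))))))
          where
          rearrange : e y + (∑ d xs + ∑ e ys) ≡ ∑ d xs + (e y + ∑ e ys)
          rearrange = trans (sym (+-assoc _ _ _))
            (trans (cong (_+ ∑ e ys) (+-comm _ _)) (+-assoc _ _ _))

      fibres-lower : IsUpperBound _≤_ (PartialSum T e) u →
                     IsUpperBound _≤_ (PartialSum (f ⊢ T) d) u
      fibres-lower e≤u (xs , xs! , Txs , refl) = ≤-trans
        (∑-group ys (DecUnique.deduplicate-! _≟_ _) xs xs!
          (All.tabulate λ x∈ → ∈-deduplicate⁺ _≟_ (∈-map⁺ f x∈)))
        (e≤u ( ys , DecUnique.deduplicate-! _≟_ _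
             , All.tabulate (λ y∈ →
                 let _ , x∈ , y≡fx = ∈-map⁻ f (∈-deduplicate⁻ _≟_ (map f xs) y∈)
                 in subst T (sym y≡fx) (All.lookup Txs x∈))
             , refl))
        where
        ys = deduplicate _≟_ (map f xs)

  HasSum-singleton : {X : Set} {d : X → ℝ} → (∀ x → 0# ≤ d x) →
                     ∀ y → HasSum (λ x → x ≡ y) d (d y)
  HasSum-singleton {X} {d} 0≤d y = ub , λ u-ub →
      subst (_≤ _) (+-identityʳ _) (u-ub (y ∷ [] , [] ∷ [] , refl ∷ [] , refl))
    where
    ub : IsUpperBound _≤_ (PartialSum (λ x → x ≡ y) d) (d y)
    ub ([] , _ , _ , refl)                              = 0≤d y
    ub (_ ∷ [] , _ , refl ∷ _ , refl)                   = ≤-reflexive (+-identityʳ _)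
    ub (_ ∷ _ ∷ _ , (x≢x′ ∷ _) ∷ _ , refl ∷ refl ∷ _ , _) = ⊥-elim (x≢x′ refl)

-- Excluded middle and function extensionality are
-- part of the ambient theory of sets.
module Distributions
  (em : ExcludedMiddle 0ℓ) (ext : Extensionality 0ℓ 0ℓ) (𝓡 : CompleteOrderedField)
  where
  open CompleteOrderedField 𝓡 public
  open OrderedFieldProperties 𝓡
  open Sums 𝓡
  open Fibres em 𝓡

  𝕀 : Set
  𝕀 = [ x ∈ ℝ ∣ 0# ≤ x × x ≤ 1# ]

  _≤𝕀_ : Rel 𝕀 0ℓ
  a ≤𝕀 b = value a ≤ value b

  0≤value : (a : 𝕀) → 0# ≤ value a
  0≤value (_ , [ p ]) = proj₁ (recompute em p)

  value≤1 : (a : 𝕀) → value a ≤ 1#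
  value≤1 (_ , [ p ]) = proj₂ (recompute em p)

  1𝕀 : 𝕀
  1𝕀 = 1# , [ (0≤1 , ≤-refl) ]

  scale : (γ : ℝ) → 0# ≤ γ → γ < 1# → 𝕀 → 𝕀
  scale γ 0≤γ (γ≤1 , _) a = γ * value a ,
    [ ( *-nonNeg 0≤γ (0≤value a)
      , ≤-trans (*-monoˡ-≤ (0≤value a) γ≤1)
          (subst (_≤ 1#) (sym (*-identityˡ _)) (value≤1 a))) ]

  𝒟 : Set → Set
  𝒟 X = [ d ∈ (X → 𝕀) ∣ HasSum U (value ∘ d) 1# ]

  mass : {X : Set} → 𝒟 X → X → ℝ
  mass d x = value (value d x)

  0≤mass : {X : Set} (d : 𝒟 X) (x : X) → 0# ≤ mass d x
  0≤mass d x = 0≤value (value d x)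

  HasSum-mass : {X : Set} (d : 𝒟 X) → HasSum U (mass d) 1#
  HasSum-mass (_ , [ p ]) = recompute em p

  supp : {X : Set} → 𝒟 X → Pred X 0ℓ
  supp d x = 0# < mass d x

  mass-bounded : {X : Set} (d : 𝒟 X) (S : Pred X 0ℓ) →
                 IsUpperBound _≤_ (PartialSum S (mass d)) 1#
  mass-bounded d S (xs , xs! , _ , eq) =
    proj₁ (HasSum-mass d) (xs , xs! , All.universal (λ _ → tt) xs , eq)

  sum≤1 : {X : Set} (S : Pred X 0ℓ) (f : X → ℝ) →
          IsUpperBound _≤_ (PartialSum S f) 1# → ∃ (HasSum S f) → 𝕀
  sum≤1 S f bound (s , s-sum) = s , [ (HasSum-nonNeg s-sum , proj₂ s-sum bound) ]

  fibreSum : {X Y : Set} (f : X → Y) (d : 𝒟 X) (y : Y) →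
             ∃ (HasSum (λ x → f x ≡ y) (mass d))
  fibreSum f d y = sumExists _ _ (1# , mass-bounded d _)

  𝒟-map : {X Y : Set} → (X → Y) → 𝒟 X → 𝒟 Y
  𝒟-map f d =
    (λ y → sum≤1 _ _ (mass-bounded d _) (fibreSum f d y)) ,
    [ ( fibres-upper f (mass d) _ (proj₂ ∘ fibreSum f d) U (proj₁ (HasSum-mass d))
      , λ u-ub → proj₂ (HasSum-mass d)
          (fibres-lower f (mass d) _ (proj₂ ∘ fibreSum f d) U u-ub)) ]

  𝕀-≡ : {a b : 𝕀} → value a ≡ value b → a ≡ b
  𝕀-≡ refl = refl

  𝒟-≡ : {X : Set} {d e : 𝒟 X} → (∀ x → mass d x ≡ mass e x) → d ≡ e
  𝒟-≡ {X} {d} {e} eq = helper (ext λ x → 𝕀-≡ (eq x))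
    where
    helper : value d ≡ value e → d ≡ e
    helper refl = refl

  F-p : SetFunctor
  F-p = record
    { F₀           = λ X → 𝒟 X × Fin 2
    ; F₁           = λ f (d , t) → 𝒟-map f d , t
    ; identity     = ext λ (d , t) → cong (_, t) (𝒟-≡ λ y →
        LUB-unique id id (proj₂ (fibreSum id d y)) (HasSum-singleton (0≤mass d) y))
    ; homomorphism = λ f g → ext λ (d , t) → cong (_, t) (𝒟-≡ λ z →
        LUB-unique
          (λ ub → fibres-upper f (mass d) _ (proj₂ ∘ fibreSum f d) (λ y → g y ≡ z) ub)
          (λ ub → fibres-lower f (mass d) _ (proj₂ ∘ fibreSum f d) (λ y → g y ≡ z) ub)
          (proj₂ (fibreSum (g ∘ f) d z))
          (proj₂ (fibreSum g (𝒟-map f d) z)))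
    }

  open SetFunctor F-p public using () renaming (F₀ to Fp)

  weighted : 𝒟 𝕀 → 𝕀 → ℝ
  weighted δ a = value a * mass δ a

  weighted-bounded : (δ : 𝒟 𝕀) → IsUpperBound _≤_ (PartialSum (supp δ) (weighted δ)) 1#
  weighted-bounded δ (as , as! , as⊆ , refl) =
    ≤-trans (∑-mono weighted≤mass as) (mass-bounded δ (supp δ) (as , as! , as⊆ , refl))
    where
    weighted≤mass : ∀ a → weighted δ a ≤ mass δ a
    weighted≤mass a = subst (weighted δ a ≤_) (*-identityˡ _)
      (*-monoˡ-≤ (0≤mass δ a) (value≤1 a))

  mean : 𝒟 𝕀 → 𝕀
  mean δ = sum≤1 (supp δ) (weighted δ) (weighted-bounded δ)
    (sumExists (supp δ) (weighted δ) (1# , weighted-bounded δ))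

  σ-p : Fp 𝕀 → 𝕀
  σ-p (δ , 0F) = mean δ
  σ-p (δ , 1F) = 1𝕀

  r-nc : (γ : ℝ) → 0# ≤ γ → γ < 1# → Fp 𝕀 → 𝕀
  r-nc γ 0≤γ γ<1 (φ , 0F) = scale γ 0≤γ γ<1 (mean φ)
  r-nc γ 0≤γ γ<1 (φ , 1F) = 1𝕀

  q-nc : 𝕀 → 𝕀
  q-nc a = a

{-# OPTIONS --safe #-}
-- Along a map f from a set X to the unit interval, the mean of the pushforward
-- of d is the sum over X of f x * d x.  Hence f ≤ g + s pointwise implies
-- mean f ≤ mean g + s; with s = 0 this is monotonicity.  Fixed points of Φ
-- exist by Knaster–Tarski.  If f and g are two of them and s is the supremum
-- of f - g, taken together with 0, then γ * s is also an upper bound, so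
-- s ≤ γ * s, and γ < 1 forces s = 0, that is, f ≤ g.
module Submission where

open import Defs
open import Axiom.ExcludedMiddle using (ExcludedMiddle)
open import Axiom.Extensionality.Propositional using (Extensionality)
open import Data.Empty using (⊥-elim)
open import Data.Fin.Patterns using (0F; 1F)
open import Data.Irrelevant using ([_])
open import Data.List.Base using (List; []; _∷_; filter)
open import Data.List.Relation.Unary.All as All using (All; []; _∷_)
import Data.List.Relation.Unary.All.Properties as All
open import Data.List.Relation.Unary.AllPairs using ([])
import Data.List.Relation.Unary.Unique.Propositional.Properties as Unique
open import Data.Product.Base using (∃; _×_; _,_; proj₁; proj₂)
open import Data.Refinement using (_,_; value)
open import Data.Sum.Base using (_⊎_; inj₁; inj₂)
open import Data.Unit.Base using (tt)
open import Function.Base using (_∘_; id; flip)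
open import Level using (0ℓ)
open import Relation.Binary.Core using (Rel)
open import Relation.Binary.PropositionalEquality
  using (_≡_; refl; sym; trans; cong; cong₂; subst; subst₂; isEquivalence)
open import Relation.Binary.Structures using (IsPartialOrder; IsTotalOrder)
open import Relation.Nullary.Decidable using (yes; no; decidable-stable)
open import Relation.Nullary.Negation.Core using (¬_)
open import Relation.Unary using (Pred; U; Decidable)
import Algebra.Properties.CommutativeSemigroup as CommutativeSemigroupProperties
open import Algebra.Bundles using (CommutativeRing)

-- Fixed points of monotone operators on functions into a complete lattice.

module _ {A : Set} {_≤_ : Rel A 0ℓ} (L : IsCompleteLattice _≤_) where
  open IsCompleteLattice L
  open IsPartialOrder isPartialOrder using (antisym) renaming (trans to ≤-trans)

  knasterTarski : {X : Set} (Ψ : (X → A) → X → A) →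
    (∀ {f g} → Pointwise _≤_ f g → Pointwise _≤_ (Ψ f) (Ψ g)) →
    ∃ λ f → ∀ x → f x ≡ Ψ f x
  knasterTarski {X} Ψ mono = μ , λ x →
      -- By monotonicity `Ψ μ` is itself prefixed, so `μ` lies below it.
      antisym (μ-least (mono Ψμ≤μ) x) (Ψμ≤μ x)
    where
    -- Only `A` is assumed complete, so the meet of all prefixed points is formed pointwise, from
    -- their values at each `x`.
    Prefixed : X → Pred A 0ℓ
    Prefixed x a = ∃ λ h → Pointwise _≤_ (Ψ h) h × a ≡ h x

    μ : X → A
    μ x = ⨅ (Prefixed x)

    μ-least : ∀ {h} → Pointwise _≤_ (Ψ h) h → Pointwise _≤_ μ h
    μ-least Ψh≤h x = proj₁ (⨅-isGLB (Prefixed x)) (_ , Ψh≤h , refl)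

    Ψμ≤μ : Pointwise _≤_ (Ψ μ) μ
    Ψμ≤μ x = proj₂ (⨅-isGLB (Prefixed x)) λ where
      (_ , Ψh≤h , refl) → ≤-trans (mono (μ-least Ψh≤h) x) (Ψh≤h x)

-- Inequalities in an ordered field.

module FieldLemmas (em : ExcludedMiddle 0ℓ) (𝓡 : CompleteOrderedField) where
  open CompleteOrderedField 𝓡
  open OrderedFieldProperties 𝓡

  open IsTotalOrder isTotalOrder public using (≤-respˡ-≈; ≤-respʳ-≈)

  *-monoʳ-≤ : ∀ {z x y} → 0# ≤ z → x ≤ y → z * x ≤ z * y
  *-monoʳ-≤ 0≤z x≤y = subst₂ _≤_ (*-comm _ _) (*-comm _ _) (*-monoˡ-≤ 0≤z x≤y)

  +-monoʳ-≤ : ∀ z {x y} → x ≤ y → z + x ≤ z + y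
  +-monoʳ-≤ z = +-mono-≤ ≤-refl

  -- Otherwise `y ≤ 0#`, and multiplying by `x` gives `1# ≤ 0#`.
  inverse-nonNeg : ∀ {x y} → 0# ≤ x → x * y ≡ 1# → 0# ≤ y
  inverse-nonNeg {x} {y} 0≤x xy≡1 with total 0# y
  ... | inj₁ 0≤y = 0≤y
  ... | inj₂ y≤0 = ⊥-elim (0≢1 (antisym 0≤1
    (subst₂ _≤_ xy≡1 (zeroʳ x) (*-monoʳ-≤ 0≤x y≤0))))

  -- If `x` were nonzero, multiplying by its nonnegative inverse would give `1# ≤ γ`.
  x≤γx⇒x≡0 : ∀ {γ x} → γ < 1# → 0# ≤ x → x ≤ γ * x → x ≡ 0#
  x≤γx⇒x≡0 {γ} {x} (γ≤1 , γ≢1) 0≤x x≤γx = decidable-stable em λ x≢0 →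
    let y , xy≡1 = inverse x x≢0 in
    γ≢1 (antisym γ≤1 (subst₂ _≤_ xy≡1
      (trans (*-assoc γ x y) (trans (cong (γ *_) xy≡1) (*-identityʳ γ)))
      (*-monoˡ-≤ (inverse-nonNeg 0≤x xy≡1) x≤γx)))
    where open CommutativeRing commutativeRing using (*-assoc)

-- Finite sums and suprema of partial sums.

module SumLemmas (em : ExcludedMiddle 0ℓ) (𝓡 : CompleteOrderedField) where
  open CompleteOrderedField 𝓡
  open OrderedFieldProperties 𝓡
  open Sums 𝓡
  open FieldLemmas em 𝓡
  open CommutativeRing commutativeRing using (+-commutativeSemigroup; *-assoc)
  open CommutativeSemigroupProperties +-commutativeSemigroup using (interchange)

  ∑-+ : {X : Set} (f g : X → ℝ) (xs : List X) →
        ∑ (λ x → f x + g x) xs ≡ ∑ f xs + ∑ g xs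
  ∑-+ f g []       = sym (+-identityˡ 0#)
  ∑-+ f g (x ∷ xs) =
    trans (cong (f x + g x +_) (∑-+ f g xs)) (interchange _ _ _ _)

  ∑-scale : {X : Set} {S : Pred X 0ℓ} {f g : X → ℝ} {a : ℝ} →
            (∀ {x} → S x → g x ≡ a * f x) →
            ∀ {xs} → All S xs → ∑ g xs ≡ a * ∑ f xs
  ∑-scale         g≡af []         = sym (zeroʳ _)
  ∑-scale {a = a} g≡af (Sx ∷ Sxs) =
    trans (cong₂ _+_ (g≡af Sx) (∑-scale g≡af Sxs)) (sym (distribˡ a _ _))

  ∑-filter : {X : Set} {S : Pred X 0ℓ} (S? : Decidable S) {f : X → ℝ} →
             (∀ {x} → ¬ S x → f x ≡ 0#) →
             ∀ xs → ∑ f xs ≡ ∑ f (filter S? xs)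
  ∑-filter S? f≡0 [] = refl
  ∑-filter S? {f} f≡0 (x ∷ xs) with S? x
  ... | yes _  = cong (f x +_) (∑-filter S? f≡0 xs)
  ... | no ¬Sx =
    trans (cong₂ _+_ (f≡0 ¬Sx) (∑-filter S? f≡0 xs)) (+-identityˡ _)

  -- Discarding the entries outside `S` does not change a finite sum, so both families of partial
  -- sums have the same upper bounds.
  HasSum-extend : {X : Set} {S : Pred X 0ℓ} {f : X → ℝ} {s : ℝ} →
                  (∀ {x} → ¬ S x → f x ≡ 0#) → HasSum S f s → HasSum U f s
  HasSum-extend {S = S} f≡0 (s-ub , s-least) =
    (λ where
      (xs , xs! , _ , refl) → ≤-respˡ-≈ (sym (∑-filter S? f≡0 xs))
        (s-ub (_ , Unique.filter⁺ S? xs! , All.all-filter S? xs , refl))) ,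
    λ u-ub → s-least λ (xs , xs! , _ , eq) →
      u-ub (xs , xs! , All.universal (λ _ → tt) xs , eq)
    where
    S? : Decidable S
    S? _ = em

  -- The equation is required on `S` only, so that it can be applied on a single fibre of a map.
  HasSum-scale : {X : Set} {S : Pred X 0ℓ} {f g : X → ℝ} {a s : ℝ} → 0# ≤ a →
                 (∀ {x} → S x → g x ≡ a * f x) → HasSum S f s → HasSum S g (a * s)
  HasSum-scale {S = S} {f} {g} {a} {s} 0≤a g≡af (s-ub , s-least) =
    (λ where
      (xs , xs! , Sxs , refl) → ≤-respˡ-≈ (sym (∑-scale g≡af Sxs))
        (*-monoʳ-≤ 0≤a (s-ub (xs , xs! , Sxs , refl)))) ,
    least
    where
    least : ∀ {u} → IsUpperBound _≤_ (PartialSum S g) u → a * s ≤ u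
    least {u} u-ub with em {P = a ≡ 0#}
    -- There is no dividing by zero; the empty partial sum already gives `0# ≤ u`.
    ... | yes refl = ≤-respˡ-≈ (sym (trans (*-comm 0# s) (zeroʳ s)))
                       (u-ub ([] , [] , [] , refl))
    -- Dividing by `a` turns the bound `u` for `g` into the bound `y * u` for `f`; hence
    -- `s ≤ y * u`, and multiplying back by `a` finishes.
    ... | no a≢0 = ≤-respʳ-≈ (a[yv]≡v u) (*-monoʳ-≤ 0≤a (s-least λ where
        (xs , xs! , Sxs , refl) → ≤-respˡ-≈ (y[av]≡v (∑ f xs))
          (*-monoʳ-≤ 0≤y (≤-respˡ-≈ (∑-scale g≡af Sxs)
            (u-ub (xs , xs! , Sxs , refl))))))
      where
      y : ℝ
      y = proj₁ (inverse a a≢0)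
      ay≡1 : a * y ≡ 1#
      ay≡1 = proj₂ (inverse a a≢0)
      0≤y : 0# ≤ y
      0≤y = inverse-nonNeg 0≤a ay≡1
      a[yv]≡v : ∀ v → a * (y * v) ≡ v
      a[yv]≡v v = trans (sym (*-assoc a y v))
        (trans (cong (_* v) ay≡1) (*-identityˡ v))
      y[av]≡v : ∀ v → y * (a * v) ≡ v
      y[av]≡v v = trans (sym (*-assoc y a v))
        (trans (cong (_* v) (trans (*-comm y a) ay≡1)) (*-identityˡ v))

module MeanLemmas
  (em : ExcludedMiddle 0ℓ) (ext : Extensionality 0ℓ 0ℓ) (𝓡 : CompleteOrderedField)
  where
  open Distributions em ext 𝓡
  open OrderedFieldProperties 𝓡
  open Sums 𝓡
  open Fibres em 𝓡
  open FieldLemmas em 𝓡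
  open SumLemmas em 𝓡
  open SetFunctor F-p using (F₁)

  -- The unit interval as a complete lattice.

  ≤𝕀-isPartialOrder : IsPartialOrder _≡_ _≤𝕀_
  ≤𝕀-isPartialOrder = record
    { isPreorder = record
      { isEquivalence = isEquivalence
      ; reflexive     = λ { refl → ≤-refl }
      ; trans         = ≤-trans
      }
    ; antisym = λ a≤b b≤a → 𝕀-≡ (antisym a≤b b≤a)
    }

  -- The join of the empty set must be 0, whence the left summand.
  Values₀ : Pred 𝕀 0ℓ → Pred ℝ 0ℓ
  Values₀ K t = t ≡ 0# ⊎ ∃ λ a → K a × t ≡ value a

  Values₀≤1 : ∀ K → IsUpperBound _≤_ (Values₀ K) 1#
  Values₀≤1 K (inj₁ refl)           = 0≤1
  Values₀≤1 K (inj₂ (a , _ , refl)) = value≤1 a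

  supremum : (K : Pred 𝕀 0ℓ) → ∃ (IsLUB _≤_ (Values₀ K))
  supremum K = complete (Values₀ K) (0# , inj₁ refl) (1# , Values₀≤1 K)

  join : Pred 𝕀 0ℓ → 𝕀
  join K = let s , s-ub , s-least = supremum K in
    s , [ (s-ub (inj₁ refl) , s-least (Values₀≤1 K)) ]

  join-isLUB : ∀ K → IsLUB _≤𝕀_ K (join K)
  join-isLUB K = let _ , s-ub , s-least = supremum K in
    (λ Ka → s-ub (inj₂ (_ , Ka , refl))) ,
    λ {u} u-ub → s-least λ where
      (inj₁ refl)            → 0≤value u
      (inj₂ (_ , Ka , refl)) → u-ub Ka

  LowerBound : Pred 𝕀 0ℓ → Pred 𝕀 0ℓ
  LowerBound K = IsUpperBound (flip _≤𝕀_) K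

  ≤𝕀-isCompleteLattice : IsCompleteLattice _≤𝕀_
  ≤𝕀-isCompleteLattice = record
    { isPartialOrder = ≤𝕀-isPartialOrder
    ; ⨆              = join
    ; ⨆-isLUB        = join-isLUB
    -- A meet is the join of the lower bounds: every member of `K` bounds them from above, hence
    -- also bounds their join.
    ; ⨅              = λ K → join (LowerBound K)
    ; ⨅-isGLB        = λ K →
        let ub , least = join-isLUB (LowerBound K) in
        (λ {a} Ka → least {a} λ l-lb → l-lb Ka) , λ {l} l-lb → ub {l} l-lb
    }

  -- Means of pushforward distributions.

  mass-off-supp : {X : Set} (d : 𝒟 X) {x : X} → ¬ supp d x → mass d x ≡ 0#
  mass-off-supp d {x} x∉supp = decidable-stable em λ d≢0 →
    x∉supp (0≤mass d x , d≢0 ∘ sym)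

  -- Summing over the whole interval instead of the support avoids comparing supports along a
  -- pushforward.
  HasSum-mean : (δ : 𝒟 𝕀) → HasSum U (weighted δ) (value (mean δ))
  HasSum-mean δ = HasSum-extend
    (λ {a} a∉supp → trans (cong (value a *_) (mass-off-supp δ a∉supp)) (zeroʳ _))
    (proj₂ (sumExists (supp δ) (weighted δ) (1# , weighted-bounded δ)))

  -- Change of variables: on the fibre of `f` over `a` the factor `value (f x)` is the constant
  -- `value a`, so the fibre contributes `value a` times its mass, which is the weighted term of the
  -- pushforward at `a`.
  HasSum-mean-map : {X : Set} (f : X → 𝕀) (d : 𝒟 X) →
    HasSum U (λ x → value (f x) * mass d x) (value (mean (𝒟-map f d)))
  HasSum-mean-map f d =
    let m-ub , m-least = HasSum-mean (𝒟-map f d) in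
      (λ p → fibres-lower f w e w-sum U m-ub p)
    , (λ u-ub → m-least (λ p → fibres-upper f w e w-sum U u-ub p))
    where
    w = λ x → value (f x) * mass d x
    e = weighted (𝒟-map f d)
    w-sum : ∀ a → HasSum (λ x → f x ≡ a) w (e a)
    w-sum a = HasSum-scale (0≤value a) (λ { refl → refl })
      (proj₂ (fibreSum f d a))

  -- It suffices to bound finite partial sums. There the error terms `s * mass d x` add up to at
  -- most `s`, because the masses add up to at most 1.
  mean-map-≤ : {X : Set} {f g : X → 𝕀} {s : ℝ} → 0# ≤ s →
    (∀ x → value (f x) ≤ value (g x) + s) → (d : 𝒟 X) →
    value (mean (𝒟-map f d)) ≤ value (mean (𝒟-map g d)) + s
  mean-map-≤ {f = f} {g} {s} 0≤s f≤g+s d =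
    proj₂ (HasSum-mean-map f d) λ where
      (xs , xs! , _ , refl) → ≤-trans (∑-mono pointwise xs)
        (≤-respˡ-≈ (sym (∑-+ _ _ xs)) (+-mono-≤
          (proj₁ (HasSum-mean-map g d) (xs , xs! , All.universal (λ _ → tt) xs , refl))
          (subst₂ _≤_ (sym (∑-scale (λ _ → refl) (All.universal (λ _ → tt) xs)))
            (*-identityʳ s)
            (*-monoʳ-≤ 0≤s
              (mass-bounded d U (xs , xs! , All.universal (λ _ → tt) xs , refl))))))
    where
    pointwise : ∀ x → value (f x) * mass d x ≤ value (g x) * mass d x + s * mass d x
    pointwise x = ≤-respʳ-≈ (distribʳ _ _ _) (*-monoˡ-≤ (0≤mass d x) (f≤g+s x))

  mean-map-mono : {X : Set} {f g : X → 𝕀} → Pointwise _≤𝕀_ f g → (d : 𝒟 X) →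
    mean (𝒟-map f d) ≤𝕀 mean (𝒟-map g d)
  mean-map-mono {f = f} {g} f≤g d = ≤-respʳ-≈ (+-identityʳ _)
    (mean-map-≤ {f = f} {g} ≤-refl (λ x → ≤-respʳ-≈ (sym (+-identityʳ _)) (f≤g x)) d)

  σ-map-mono : {X : Set} {f g : X → 𝕀} → Pointwise _≤𝕀_ f g → (p : Fp X) →
    σ-p (F₁ f p) ≤𝕀 σ-p (F₁ g p)
  σ-map-mono f≤g (d , 0F) = mean-map-mono f≤g d
  σ-map-mono f≤g (d , 1F) = ≤-refl

  -- Contraction and corecursiveness of the discounted algebra.

  module Discounted (γ : ℝ) (0≤γ : 0# ≤ γ) (γ<1 : γ < 1#) where

    r : Fp 𝕀 → 𝕀
    r = r-nc γ 0≤γ γ<1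

    r≤σ : Pointwise _≤𝕀_ r σ-p
    r≤σ (φ , 0F) =
      ≤-respʳ-≈ (*-identityˡ _) (*-monoˡ-≤ (0≤value (mean φ)) (proj₁ γ<1))
    r≤σ (φ , 1F) = ≤-refl

    r-map-mono : {X : Set} {f g : X → 𝕀} → Pointwise _≤𝕀_ f g → (p : Fp X) →
      r (F₁ f p) ≤𝕀 r (F₁ g p)
    r-map-mono f≤g (d , 0F) = *-monoʳ-≤ 0≤γ (mean-map-mono f≤g d)
    r-map-mono f≤g (d , 1F) = ≤-refl

    -- A one-sided contraction estimate: the discount multiplies the error `s` of the means by `γ`.
    r-map-≤ : {X : Set} {f g : X → 𝕀} {s : ℝ} → 0# ≤ s →
      (∀ x → value (f x) ≤ value (g x) + s) → (p : Fp X) →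
      value (r (F₁ f p)) ≤ value (r (F₁ g p)) + γ * s
    r-map-≤ {f = f} {g} 0≤s f≤g+s (d , 0F) =
      ≤-respʳ-≈ (distribˡ γ _ _) (*-monoʳ-≤ 0≤γ (mean-map-≤ {f = f} {g} 0≤s f≤g+s d))
    -- Both values are 1 here, so only `0# ≤ γ * s` is needed.
    r-map-≤ 0≤s f≤g+s (d , 1F) =
      ≤-respˡ-≈ (+-identityʳ 1#) (+-monoʳ-≤ 1# (*-nonNeg 0≤γ 0≤s))

    module _ {X : Set} (c : X → Fp X) where

      fixedPoint-≤ : {f g : X → 𝕀} → f ≡ Φ F-p c r f → g ≡ Φ F-p c r g →
                     Pointwise _≤𝕀_ f g
      fixedPoint-≤ {f} {g} f≡Φf g≡Φg x =
        ≤-respʳ-≈ (trans (cong (value (g x) +_) s≡0) (+-identityʳ _))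
          (f≤g+s x)
        where
        -- Including 0 keeps the set inhabited when `X` is empty and makes its supremum nonnegative,
        -- as `r-map-≤` demands.
        Gap₀ : Pred ℝ 0ℓ
        Gap₀ t = t ≡ 0# ⊎ ∃ λ y → t ≡ value (f y) + (- value (g y))

        -- Applied with 1 to obtain the supremum `s`, and then with `γ * s` to compare it with its
        -- own multiple.
        bounded-by : ∀ {u} → 0# ≤ u → (∀ y → value (f y) ≤ value (g y) + u) →
                     IsUpperBound _≤_ Gap₀ u
        bounded-by 0≤u f≤g+u (inj₁ refl)       = 0≤u
        bounded-by 0≤u f≤g+u (inj₂ (y , refl)) =
          ≤-respʳ-≈ ([x+y]-y≡x _ _)
            (+-monoˡ-≤ _ (≤-respʳ-≈ (+-comm _ _) (f≤g+u y)))

        f≤g+1 : ∀ y → value (f y) ≤ value (g y) + 1#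
        f≤g+1 y = ≤-trans (value≤1 (f y))
          (≤-respˡ-≈ (+-identityˡ 1#) (+-monoˡ-≤ 1# (0≤value (g y))))

        gap : ∃ (IsLUB _≤_ Gap₀)
        gap = complete Gap₀ (0# , inj₁ refl) (1# , bounded-by 0≤1 f≤g+1)

        s : ℝ
        s = proj₁ gap

        0≤s : 0# ≤ s
        0≤s = proj₁ (proj₂ gap) (inj₁ refl)

        f≤g+s : ∀ y → value (f y) ≤ value (g y) + s
        f≤g+s y = subst₂ _≤_ ([x-y]+y≡x _ _) (+-comm _ _)
          (+-monoˡ-≤ (value (g y)) (proj₁ (proj₂ gap) (inj₂ (y , refl))))

        f≤g+γs : ∀ y → value (f y) ≤ value (g y) + γ * s
        -- Both fixed-point equations are unfolded once, which exposes `r` and gains the factor `γ`.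
        f≤g+γs y = subst₂ (λ F G → value (F y) ≤ value (G y) + γ * s)
          (sym f≡Φf) (sym g≡Φg) (r-map-≤ 0≤s f≤g+s (c y))

        s≡0 : s ≡ 0#
        s≡0 = x≤γx⇒x≡0 γ<1 0≤s
          (proj₂ (proj₂ gap) (bounded-by (*-nonNeg 0≤γ 0≤s) f≤g+γs))

    -- Uniqueness uses `fixedPoint-≤` in both directions, then antisymmetry at each point.
    r-corecursive : Corecursive F-p r
    r-corecursive c =
      let f , f≡Φf = knasterTarski ≤𝕀-isCompleteLattice (Φ F-p c r)
                       (λ f≤g → r-map-mono f≤g ∘ c)
      in f , ext f≡Φf , λ g≡Φg → ext λ x → 𝕀-≡
        (antisym (fixedPoint-≤ c (ext f≡Φf) g≡Φg x)
                 (fixedPoint-≤ c g≡Φg (ext f≡Φf) x))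

mainTheorem3 : (em : ExcludedMiddle 0ℓ) (ext : Extensionality 0ℓ 0ℓ) (𝓡 : CompleteOrderedField) →
    let open Distributions em ext 𝓡 in
    (γ : ℝ) (0≤γ : 0# ≤ γ) (γ<1 : γ < 1#) →
    IsRankingDomain F-p _≤𝕀_ σ-p (r-nc γ 0≤γ γ<1) q-nc _≤𝕀_
mainTheorem3 em ext 𝓡 γ 0≤γ γ<1 = record
  { Ω-isCompleteLattice = ≤𝕀-isCompleteLattice
  ; σ-monotone          = λ c f≤g → σ-map-mono f≤g ∘ c
  ; R-isCompleteLattice = ≤𝕀-isCompleteLattice
  -- Since `q-nc` is the identity, the functor's identity law reduces the claim to `r≤σ`; the law
  -- holds only propositionally, hence the transport.
  ; lax                 = λ p → subst (λ h → r p ≤𝕀 σ-p (h p)) (sym identity) (r≤σ p)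
  ; r-monotone          = λ c f≤g → r-map-mono f≤g ∘ c
  ; q-monotone          = id
  -- Both bottoms are the empty join of the same lattice.
  ; q-strict            = refl
  -- The image of `K` under the identity has the same members as `K`, so each join bounds the other
  -- set.
  ; q-continuous        = λ K →
      let K-ub , K-least = join-isLUB K
          I-ub , I-least = join-isLUB (Image q-nc K)
      in 𝕀-≡ (antisym
           (K-least {join (Image q-nc K)} λ Ka → I-ub (_ , Ka , refl))
           (I-least {join K} λ { (_ , Ka , refl) → K-ub Ka }))
  ; corecursive         = r-corecursive
  }
  where
  open Distributions em ext 𝓡
  open OrderedFieldProperties 𝓡 using (antisym)
  open MeanLemmas em ext 𝓡
  open Discounted γ 0≤γ γ<1
  open SetFunctor F-p using (identity)
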